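{- Let $K_n$ be the complete graph on $n$ vertices. If $n=j^2+\delta$ with $j$ a positive integer and $\delta\in\{ -2,0,2\}$, then the cordial vertex deficiency of $K_n$ is $cvd(K_n)=j-1$. If $n$ is not of this form, then $K_n$ is strictly noncordial, i.e. $cvd(K_n)=\infty$.
   Context: Graphs are finite and may have multiple edges but not loops. A binary labeling of a graph $G$ is a function $f:V(G)\to\{0,1\}$. Two real numbers $x,y$ are roughly equal if $0\le |x-y|\le 1$. A binary labeling $f$ is friendly if $|f^{ -1}(0)|$ and $|f^{ -1}(1)|$ are roughly equal. A binary labeling $f$ induces an edge labeling $f_e:E(G)\to\{0,1\}$ by $f_e(uv)=f(u)+f(v)$ modulo 2. A friendly labeling $f$ of $G$ is cordial if $|f_e^{ -1}(0)|$ and $|f_e^{ -1}(1)|$ are roughly equal. The cordial vertex deficiency $cvd(G)$ is the minimum, over all binary labelings $f$ of $G$ (not necessarily friendly) for which $|f_e^{ -1}(0)|$ and $|f_e^{ -1}(1)|$ are roughly equal, of the number of labeled vertices (added as isolated vertices, with labels in $\{0,1\}$ chosen appropriately) that must be added to $G$ so that the resulting labeling of the augmented graph $G'$ is cordial. If no such binary labeling of $G$ exists, $G$ is called strictly noncordial and $cvd(G)=\infty$.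
   Formalization: The case n = 2 is excluded from the formula cvd(K_n) = j-1, which is false there: 2 = 2^2-2 would give 1, but labeling the two vertices 0 and 1 is already cordial, so cvd(K_2) = 0. Also n is taken to be at least 1. -}

module Defs where

open import Data.Fin.Base using (Fin; zero; suc; _<_; _↑ˡ_)
open import Data.Fin.Properties using (_<?_; <⇒≢; ↑ˡ-injective)
open import Data.Integer.Base as ℤ using (ℤ; +_; -[1+_])
open import Data.List.Base using (List; []; _∷_; allFin; cartesianProduct; filter; length; lookup)
open import Data.List.Membership.Propositional using (_∈_)
open import Data.List.Membership.Propositional.Properties using (∈-lookup)
open import Data.List.Relation.Unary.All as All using ()
open import Data.List.Relation.Unary.All.Properties using (all-filter)
open import Data.Nat.Base using (ℕ; zero; suc; _+_; _∸_; _^_; _≤_; z≤n; s≤s; ∣_-_∣)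
open import Data.Parity.Base as ℙ using (Parity; 0ℙ; 1ℙ)
open import Data.Parity.Properties using () renaming (_≟_ to _≟ℙ_)
open import Data.Product.Base using (∃; _×_; _,_; proj₁; proj₂; uncurry; map)
open import Data.Vec.Functional using (Vector; _++_)
open import Function.Base using (_∘_)
open import Relation.Binary.PropositionalEquality using (_≡_; _≢_)
open import Relation.Nullary.Construct.Add.Supremum using (_⁺; ⊤⁺; [_])
open import Relation.Nullary.Negation using (¬_)

-- Finite loopless multigraphs: distinct edges may have the same ends.  The
-- order of the two ends of an edge carries no meaning.
record Graph : Set where
  field
    order    : ℕ
    size     : ℕ
    ends     : Fin size → Fin order × Fin order
    loopless : ∀ e → proj₁ (ends e) ≢ proj₂ (ends e)

open Graph public

-- Every unordered pair of distinct vertices is listed once, smaller end first.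
pairs : ∀ n → List (Fin n × Fin n)
pairs n = filter (uncurry _<?_) (cartesianProduct (allFin n) (allFin n))

K : ℕ → Graph
K n .order      = n
K n .size       = length (pairs n)
K n .ends       = lookup (pairs n)
K n .loopless e = <⇒≢ (All.lookup (all-filter (uncurry _<?_) (cartesianProduct (allFin n) (allFin n)))
                                  (∈-lookup {xs = pairs n} e))

addIsolated : Graph → ℕ → Graph
addIsolated G k .order      = order G + k
addIsolated G k .size       = size G
addIsolated G k .ends       = map (_↑ˡ k) (_↑ˡ k) ∘ ends G
addIsolated G k .loopless e = loopless G e ∘ ↑ˡ-injective k _ _

-- The labels {0,1} are the elements 0ℙ, 1ℙ of Parity, whose addition is
-- addition modulo 2.
Labeling : Graph → Set
Labeling G = Vector Parity (order G)

edgeLabeling : (G : Graph) → Labeling G → Vector Parity (size G)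
edgeLabeling G f e = f (proj₁ (ends G e)) ℙ.+ f (proj₂ (ends G e))

∣_⁻¹_∣ : ∀ {n} → Vector Parity n → Parity → ℕ
∣_⁻¹_∣ {n} f p = length (filter (λ i → f i ≟ℙ p) (allFin n))

RoughlyEqual : ℕ → ℕ → Set
RoughlyEqual x y = ∣ x - y ∣ ≤ 1

Friendly : (G : Graph) → Labeling G → Set
Friendly G f = RoughlyEqual ∣ f ⁻¹ 0ℙ ∣ ∣ f ⁻¹ 1ℙ ∣

EdgeBalanced : (G : Graph) → Labeling G → Set
EdgeBalanced G f = RoughlyEqual ∣ edgeLabeling G f ⁻¹ 0ℙ ∣ ∣ edgeLabeling G f ⁻¹ 1ℙ ∣

Cordial : (G : Graph) → Labeling G → Set
Cordial G f = Friendly G f × EdgeBalanced G f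

CordialAfterAdding : Graph → ℕ → Set
CordialAfterAdding G k =
  ∃ λ (f : Labeling G) → EdgeBalanced G f ×
  ∃ λ (g : Vector Parity k) → Cordial (addIsolated G k) (f ++ g)

StrictlyNoncordial : Graph → Set
StrictlyNoncordial G = ¬ ∃ (EdgeBalanced G)

-- IsCVD G c says cvd(G) = c, where ⊤⁺ is the value ∞.
IsCVD : Graph → ℕ ⁺ → Set
IsCVD G [ k ] = CordialAfterAdding G k × (∀ m → CordialAfterAdding G m → k ≤ m)
IsCVD G ⊤⁺    = StrictlyNoncordial G

NearSquare : ℕ → ℕ → ℤ → Set
NearSquare n j δ =
  1 ≤ j × δ ∈ (-[1+ 1 ] ∷ + 0 ∷ + 2 ∷ []) × + n ≡ + (j ^ 2) ℤ.+ δ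

-- The formula cvd(Kₙ) = j - 1 fails for n = 2 = 2² - 2: labeling the two
-- vertices differently is already cordial, so the value is 0 and not 1.
cvd-K₂ : IsCVD (K 2) [ 0 ]
cvd-K₂ = (f , s≤s z≤n , (λ ()) , z≤n , s≤s z≤n) , λ _ _ → z≤n
  where
  f : Labeling (K 2)
  f zero    = 0ℙ
  f (suc _) = 1ℙ

{-# OPTIONS --safe #-}
module Submission where

open import Defs
open import Algebra.Properties.AbelianGroup using () renaming (∙-cancelˡ to cancelˡ)
open import Data.Bool.Base using (true; false)
open import Data.Fin.Base using (Fin; zero; suc; toℕ; splitAt)
open import Data.Fin.Properties using (_<?_)
open import Data.Integer.Base using (ℤ; +_; -[1+_]; ∣_∣; 0ℤ; 1ℤ; -1ℤ; _+_; _*_; _⊖_; -_)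
import Data.Integer.Properties as ℤ
open import Data.Integer.Tactic.RingSolver using (solve-∀)
open import Data.List.Base as List using (List; []; _∷_; allFin; cartesianProduct; filter; length; lookup)
open import Data.List.Membership.Propositional using (_∈_)
import Data.List.Properties as List
open import Data.List.Relation.Unary.Any using (here; there)
open import Data.Nat.Base as ℕ using (ℕ; zero; suc; _≤_; _∸_; z≤n; s≤s; _^_; ∣_-_∣)
import Data.Nat.Properties as ℕ
import Data.Nat.Tactic.RingSolver as ℕ-Solver
open import Data.Parity.Base as ℙ using (Parity; 0ℙ; 1ℙ)
open import Data.Parity.Properties using () renaming (_≟_ to _≟ℙ_)
open import Data.Product.Base as Product using (_×_; ∃; ∃₂; ∃-syntax; _,_; proj₁; proj₂; uncurry; map₂)
open import Data.Sum.Base using (inj₁; inj₂)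
open import Data.Vec.Functional using (Vector; _++_)
open import Data.Vec.Functional.Properties using (lookup-++ˡ)
open import Function.Base using (_∘_; const; id)
open import Level using (Level)
open import Relation.Binary.PropositionalEquality using (_≡_; _≢_; _≗_; refl; sym; trans; cong; cong₂; subst; module ≡-Reasoning)
open import Relation.Nullary.Construct.Add.Supremum using (⊤⁺; [_])
open import Relation.Nullary.Decidable using (yes; no)
open import Relation.Nullary.Negation using (¬_; contradiction)

-- Read the labels 0 and 1 as the signs x = +1 and x = -1.  An edge then carries
-- the product of the signs of its ends, and (Σ xᵢ)² = n + 2 Σ_{i<j} xᵢxⱼ.  Hence
-- the edges of Kₙ are balanced iff n - (Σ xᵢ)² ∈ {-2, 0, 2}.  For n ≠ 2 this
-- determines |Σ xᵢ|, because nonzero squares never differ by 2 or 4; making the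
-- labeling friendly costs |Σ xᵢ| - 1 isolated vertices.

private
  variable
    a b : Level
    A : Set a
    B : Set b
    m n : ℕ

-- Signed sums of labels over lists.

sign : Parity → ℤ
sign 0ℙ = 1ℤ
sign 1ℙ = -1ℤ

sign-+ : ∀ p q → sign (p ℙ.+ q) ≡ sign p * sign q
sign-+ 0ℙ 0ℙ = refl
sign-+ 0ℙ 1ℙ = refl
sign-+ 1ℙ 0ℙ = refl
sign-+ 1ℙ 1ℙ = refl

sign² : ∀ p → sign p * sign p ≡ 1ℤ
sign² 0ℙ = refl
sign² 1ℙ = refl

∣sign∣ : ∀ p → ∣ sign p ∣ ≡ 1
∣sign∣ 0ℙ = refl
∣sign∣ 1ℙ = refl

signSum : (A → Parity) → List A → ℤ
signSum h []       = 0ℤ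
signSum h (x ∷ xs) = sign (h x) + signSum h xs

signSum-++ : ∀ (h : A → Parity) xs ys → signSum h (xs List.++ ys) ≡ signSum h xs + signSum h ys
signSum-++ h []       ys = sym (ℤ.+-identityˡ _)
signSum-++ h (x ∷ xs) ys =
  trans (cong (_+_ (sign (h x))) (signSum-++ h xs ys)) (sym (ℤ.+-assoc (sign (h x)) _ _))

signSum-map : ∀ (h : B → Parity) (g : A → B) xs → signSum h (List.map g xs) ≡ signSum (h ∘ g) xs
signSum-map h g []       = refl
signSum-map h g (x ∷ xs) = cong (_+_ (sign (h (g x)))) (signSum-map h g xs)

signSum-cong : ∀ {h k : A → Parity} → h ≗ k → signSum h ≗ signSum k
signSum-cong h≗k []       = refl
signSum-cong h≗k (x ∷ xs) = cong₂ _+_ (cong sign (h≗k x)) (signSum-cong h≗k xs)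

-- Serves for the edges at one vertex: their labels share the summand `p`, so the sign of that
-- vertex factors out.
signSum-shift : ∀ p (h : A → Parity) xs → signSum (λ x → p ℙ.+ h x) xs ≡ sign p * signSum h xs
signSum-shift p h []       = sym (ℤ.*-zeroʳ (sign p))
signSum-shift p h (x ∷ xs) =
  trans (cong₂ _+_ (sign-+ p (h x)) (signSum-shift p h xs))
        (sym (ℤ.*-distribˡ-+ (sign p) (sign (h x)) (signSum h xs)))

∣signSum∣≤length : ∀ (h : A → Parity) xs → ∣ signSum h xs ∣ ≤ length xs
∣signSum∣≤length h []       = z≤n
∣signSum∣≤length h (x ∷ xs) = ℕ.≤-trans (ℤ.∣i+j∣≤∣i∣+∣j∣ (sign (h x)) (signSum h xs))
  (ℕ.+-mono-≤ (ℕ.≤-reflexive (∣sign∣ (h x))) (∣signSum∣≤length h xs))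

count : (A → Parity) → Parity → List A → ℕ
count h p xs = length (filter (λ x → h x ≟ℙ p) xs)

count-difference : ∀ (h : A → Parity) xs → count h 0ℙ xs ⊖ count h 1ℙ xs ≡ signSum h xs
count-difference h []       = refl
count-difference h (x ∷ xs) with h x
... | 0ℙ = trans (sym (ℤ.distribʳ-⊖-+-pos 1 (count h 0ℙ xs) (count h 1ℙ xs)))
                 (cong (_+_ 1ℤ) (count-difference h xs))
... | 1ℙ = trans (sym (ℤ.distribʳ-⊖-+-neg 0 (count h 0ℙ xs) (count h 1ℙ xs)))
                 (cong (_+_ -1ℤ) (count-difference h xs))

-- The balance of a labeling.

balance : Vector Parity n → ℤ
balance f = signSum f (allFin _)

∣m⊖n∣≡∣m-n∣ : ∀ m n → ∣ m ⊖ n ∣ ≡ ∣ m - n ∣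
∣m⊖n∣≡∣m-n∣ zero    zero    = refl
∣m⊖n∣≡∣m-n∣ zero    (suc n) = refl
∣m⊖n∣≡∣m-n∣ (suc m) zero    = refl
∣m⊖n∣≡∣m-n∣ (suc m) (suc n) = trans (cong ∣_∣ (ℤ.[1+m]⊖[1+n]≡m⊖n m n)) (∣m⊖n∣≡∣m-n∣ m n)

-- Reduces `Friendly` and `EdgeBalanced` alike to the bound 1 on the absolute value of one integer,
-- which, unlike a distance of counts, is additive under `_++_`.
∣counts∣≡∣balance∣ : ∀ (f : Vector Parity n) → ∣ ∣ f ⁻¹ 0ℙ ∣ - ∣ f ⁻¹ 1ℙ ∣ ∣ ≡ ∣ balance f ∣
∣counts∣≡∣balance∣ f = trans (sym (∣m⊖n∣≡∣m-n∣ ∣ f ⁻¹ 0ℙ ∣ ∣ f ⁻¹ 1ℙ ∣))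
                            (cong ∣_∣ (count-difference f (allFin _)))

allFin-suc : ∀ n → allFin (suc n) ≡ zero ∷ List.map suc (allFin n)
allFin-suc n = cong (zero ∷_) (sym (List.map-tabulate id suc))

balance-suc : ∀ (f : Vector Parity (suc n)) → balance f ≡ sign (f zero) + balance (f ∘ suc)
balance-suc {n} f = trans (cong (signSum f) (allFin-suc n))
                          (cong (_+_ (sign (f zero))) (signSum-map f suc (allFin n)))

balance-++ : ∀ (f : Vector Parity m) (g : Vector Parity n) → balance (f ++ g) ≡ balance f + balance g
balance-++ {zero}  f g = sym (ℤ.+-identityˡ _)
balance-++ {suc m} {n} f g = begin
  balance (f ++ g)                                           ≡⟨ balance-suc {m ℕ.+ n} (f ++ g) ⟩
  sign (f zero) + balance ((f ++ g) ∘ suc)                 ≡⟨ cong (_+_ (sign (f zero))) (signSum-cong ++-suc (allFin _)) ⟩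
  sign (f zero) + balance ((f ∘ suc) ++ g)                 ≡⟨ cong (_+_ (sign (f zero))) (balance-++ (f ∘ suc) g) ⟩
  sign (f zero) + (balance (f ∘ suc) + balance g)        ≡⟨ ℤ.+-assoc (sign (f zero)) _ _ ⟨
  sign (f zero) + balance (f ∘ suc) + balance g          ≡⟨ cong (_+ balance g) (balance-suc f) ⟨
  balance f + balance g                                    ∎
  where
  open ≡-Reasoning
  ++-suc : (f ++ g) ∘ suc ≗ (f ∘ suc) ++ g
  -- `splitAt (suc m) (suc i)` is computed from `splitAt m i`, so this one split lets both sides
  -- reduce.
  ++-suc i with splitAt m i
  ... | inj₁ _ = refl
  ... | inj₂ _ = refl

balance-const : ∀ n p → balance {n} (const p) ≡ + n * sign p
balance-const zero    p = refl
balance-const (suc n) p = begin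
  balance {suc n} (const p)         ≡⟨ balance-suc {n} (const p) ⟩
  sign p + balance {n} (const p)  ≡⟨ cong (_+_ (sign p)) (balance-const n p) ⟩
  sign p + + n * sign p         ≡⟨ ℤ.suc-* (+ n) (sign p) ⟨
  + suc n * sign p                ∎
  where open ≡-Reasoning

∣balance∣≤n : ∀ (f : Vector Parity n) → ∣ balance f ∣ ≤ n
∣balance∣≤n f = subst (∣ balance f ∣ ≤_) (List.length-tabulate id) (∣signSum∣≤length f (allFin _))

-- The edge list of a complete graph, one vertex at a time.

ends< : ∀ {n} → List (Fin n × Fin n) → List (Fin n × Fin n)
ends< = filter (uncurry _<?_)

ends<-map-suc : ∀ (xs : List (Fin n × Fin n)) →
  ends< (List.map (Product.map suc suc) xs) ≡ List.map (Product.map suc suc) (ends< xs)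
ends<-map-suc []             = refl
-- The test `_<?_` computes to this boolean for `(i , j)` and for `(suc i , suc j)`, so both filters
-- take the same branch.
ends<-map-suc ((i , j) ∷ xs) with toℕ i ℕ.<ᵇ toℕ j
... | true  = cong ((suc i , suc j) ∷_) (ends<-map-suc xs)
... | false = ends<-map-suc xs

ends<-zero : ∀ (js : List (Fin n)) →
  ends< (List.map (zero ,_) (List.map suc js)) ≡ List.map (λ j → zero , suc j) js
ends<-zero []       = refl
ends<-zero (j ∷ js) = cong ((zero , suc j) ∷_) (ends<-zero js)

ends<-suc : ∀ (is js : List (Fin n)) →
  ends< (cartesianProduct (List.map suc is) (zero ∷ List.map suc js))
    ≡ List.map (Product.map suc suc) (ends< (cartesianProduct is js))
ends<-suc []       js = refl
-- The pair `(suc i , zero)` at the head of the row is rejected by computation, so the chain starts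
-- behind it.
ends<-suc (i ∷ is) js = begin
  ends< (List.map (suc i ,_) (List.map suc js) List.++ rest)
    ≡⟨ List.filter-++ (uncurry _<?_) (List.map (suc i ,_) (List.map suc js)) rest ⟩
  ends< (List.map (suc i ,_) (List.map suc js)) List.++ ends< rest
    ≡⟨ cong₂ List._++_ (cong ends< row) (ends<-suc is js) ⟩
  ends< (List.map s (List.map (i ,_) js)) List.++ List.map s (ends< (cartesianProduct is js))
    ≡⟨ cong (List._++ List.map s (ends< (cartesianProduct is js))) (ends<-map-suc (List.map (i ,_) js)) ⟩
  List.map s (ends< (List.map (i ,_) js)) List.++ List.map s (ends< (cartesianProduct is js))
    ≡⟨ List.map-++ s (ends< (List.map (i ,_) js)) _ ⟨
  List.map s (ends< (List.map (i ,_) js) List.++ ends< (cartesianProduct is js))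
    ≡⟨ cong (List.map s) (List.filter-++ (uncurry _<?_) (List.map (i ,_) js) _) ⟨
  List.map s (ends< (cartesianProduct (i ∷ is) js)) ∎
  where
  open ≡-Reasoning
  s    = Product.map suc suc
  rest = cartesianProduct (List.map suc is) (zero ∷ List.map suc js)
  row : List.map (suc i ,_) (List.map suc js) ≡ List.map s (List.map (i ,_) js)
  row = trans (sym (List.map-∘ js)) (List.map-∘ js)

-- The edges at vertex `zero` come first, then a shifted copy of the smaller complete graph. The
-- pair `(zero , zero)` drops out by computation.
pairs-suc : ∀ n → pairs (suc n) ≡
  List.map (λ j → zero , suc j) (allFin n) List.++ List.map (Product.map suc suc) (pairs n)
pairs-suc n = begin
  pairs (suc n)
    ≡⟨ cong (λ is → ends< (cartesianProduct is is)) (allFin-suc n) ⟩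
  ends< (List.map (zero ,_) (List.map suc (allFin n)) List.++ rest)
    ≡⟨ List.filter-++ (uncurry _<?_) (List.map (zero ,_) (List.map suc (allFin n))) rest ⟩
  ends< (List.map (zero ,_) (List.map suc (allFin n))) List.++ ends< rest
    ≡⟨ cong₂ List._++_ (ends<-zero (allFin n)) (ends<-suc (allFin n) (allFin n)) ⟩
  List.map (λ j → zero , suc j) (allFin n) List.++ List.map (Product.map suc suc) (pairs n) ∎
  where
  open ≡-Reasoning
  rest = cartesianProduct (List.map suc (allFin n)) (zero ∷ List.map suc (allFin n))

-- The square of the balance.

-- The second elementary symmetric polynomial of the signs.
pairSum : Vector Parity n → ℤ
pairSum f = signSum (λ (i , j) → f i ℙ.+ f j) (pairs _)

pairSum-suc : ∀ (f : Vector Parity (suc n)) →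
  pairSum f ≡ sign (f zero) * balance (f ∘ suc) + pairSum (f ∘ suc)
pairSum-suc {n} f = begin
  signSum h (pairs (suc n))
    ≡⟨ cong (signSum h) (pairs-suc n) ⟩
  signSum h (List.map (λ j → zero , suc j) (allFin n) List.++ List.map (Product.map suc suc) (pairs n))
    ≡⟨ signSum-++ h (List.map (λ j → zero , suc j) (allFin n)) _ ⟩
  signSum h (List.map (λ j → zero , suc j) (allFin n)) + signSum h (List.map (Product.map suc suc) (pairs n))
    ≡⟨ cong₂ _+_ (signSum-map h _ (allFin n)) (signSum-map h _ (pairs n)) ⟩
  signSum (λ j → f zero ℙ.+ f (suc j)) (allFin n) + pairSum (f ∘ suc)
    ≡⟨ cong (_+ pairSum (f ∘ suc)) (signSum-shift (f zero) (f ∘ suc) (allFin n)) ⟩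
  sign (f zero) * balance (f ∘ suc) + pairSum (f ∘ suc) ∎
  where
  open ≡-Reasoning
  h : _ → Parity
  h (i , j) = f i ℙ.+ f j

-- Induction on `n`: in the square of `x + s`, the term `x * x` is 1 and accounts for the new
-- vertex, while the cross term `x * s` is the contribution of its edges to `pairSum`.
balance² : ∀ (f : Vector Parity n) → balance f * balance f ≡ + n + + 2 * pairSum f
balance² {zero}  f = refl
balance² {suc n} f = begin
  balance f * balance f
    ≡⟨ cong₂ _*_ (balance-suc f) (balance-suc f) ⟩
  (x + s) * (x + s)
    ≡⟨ expand x s ⟩
  x * x + s * s + + 2 * (x * s)
    ≡⟨ cong₂ (λ u v → u + v + + 2 * (x * s)) (sign² (f zero)) (balance² (f ∘ suc)) ⟩
  1ℤ + (+ n + + 2 * e) + + 2 * (x * s)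
    ≡⟨ regroup (+ n) e (x * s) ⟩
  + suc n + + 2 * (x * s + e)
    ≡⟨ cong (λ y → + suc n + + 2 * y) (pairSum-suc f) ⟨
  + suc n + + 2 * pairSum f ∎
  where
  open ≡-Reasoning
  x = sign (f zero)
  s = balance (f ∘ suc)
  e = pairSum (f ∘ suc)
  expand : ∀ x s → (x + s) * (x + s) ≡ x * x + s * s + + 2 * (x * s)
  expand = solve-∀
  regroup : ∀ n e y → 1ℤ + (n + + 2 * e) + + 2 * y ≡ 1ℤ + n + + 2 * (y + e)
  regroup = solve-∀

-- Edge balance in terms of signs.

-- The edges are the positions of the list `pairs n`, and tabulating its `lookup` returns the list.
balance-edgeLabeling : ∀ (f : Labeling (K n)) → balance (edgeLabeling (K n) f) ≡ pairSum f
balance-edgeLabeling {n} f = begin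
  signSum (h ∘ lookup (pairs n)) (allFin _)           ≡⟨ signSum-map h (lookup (pairs n)) (allFin _) ⟨
  signSum h (List.map (lookup (pairs n)) (allFin _))  ≡⟨ cong (signSum h) (List.map-tabulate id (lookup (pairs n))) ⟩
  signSum h (List.tabulate (lookup (pairs n)))        ≡⟨ cong (signSum h) (List.tabulate-lookup (pairs n)) ⟩
  signSum h (pairs n)                                 ∎
  where
  open ≡-Reasoning
  h : _ → Parity
  h (i , j) = f i ℙ.+ f j

edgeBalanced⁺ : ∀ (f : Labeling (K n)) → ∣ pairSum f ∣ ≤ 1 → EdgeBalanced (K n) f
edgeBalanced⁺ {n} f = subst (_≤ 1) (sym (trans (∣counts∣≡∣balance∣ (edgeLabeling (K n) f)) (cong ∣_∣ (balance-edgeLabeling f))))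

edgeBalanced⁻ : ∀ (f : Labeling (K n)) → EdgeBalanced (K n) f → ∣ pairSum f ∣ ≤ 1
edgeBalanced⁻ {n} f = subst (_≤ 1) (trans (∣counts∣≡∣balance∣ (edgeLabeling (K n) f)) (cong ∣_∣ (balance-edgeLabeling f)))

-- No edge meets a new vertex, so the two edge labelings agree pointwise.
edgeBalanced-addIsolated : ∀ G k (f : Labeling G) (g : Vector Parity k) →
  EdgeBalanced G f → EdgeBalanced (addIsolated G k) (f ++ g)
edgeBalanced-addIsolated G k f g = subst (_≤ 1) (begin
  ∣ ∣ fₑ ⁻¹ 0ℙ ∣ - ∣ fₑ ⁻¹ 1ℙ ∣ ∣    ≡⟨ ∣counts∣≡∣balance∣ fₑ ⟩
  ∣ balance fₑ ∣                     ≡⟨ cong ∣_∣ (signSum-cong (λ e → sym (same e)) (allFin _)) ⟩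
  ∣ balance gₑ ∣                     ≡⟨ ∣counts∣≡∣balance∣ gₑ ⟨
  ∣ ∣ gₑ ⁻¹ 0ℙ ∣ - ∣ gₑ ⁻¹ 1ℙ ∣ ∣    ∎)
  where
  open ≡-Reasoning
  fₑ = edgeLabeling G f
  gₑ = edgeLabeling (addIsolated G k) (f ++ g)
  same : gₑ ≗ fₑ
  same e = cong₂ ℙ._+_ (lookup-++ˡ f g (proj₁ (ends G e))) (lookup-++ˡ f g (proj₂ (ends G e)))

-- Lower bound: near-square roots and their uniqueness.

square-∣_∣ : ∀ i → + (∣ i ∣ ^ 2) ≡ i * i
square-∣ + m ∣      = trans (cong (λ k → + (m ℕ.* k)) (ℕ.*-identityʳ m)) (ℤ.pos-* m m)
square-∣ -[1+ m ] ∣ = cong (λ k → + (suc m ℕ.* k)) (ℕ.*-identityʳ (suc m))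

∣i∣≤1⇒-2i∈ : ∀ i → ∣ i ∣ ≤ 1 → -[1+ 1 ] * i ∈ (-[1+ 1 ] ∷ + 0 ∷ + 2 ∷ [])
∣i∣≤1⇒-2i∈ (+ 0)      _ = there (here refl)
∣i∣≤1⇒-2i∈ (+ 1)      _ = here refl
∣i∣≤1⇒-2i∈ -[1+ 0 ]   _ = there (there (here refl))
∣i∣≤1⇒-2i∈ (+ suc (suc _))    (s≤s ())
∣i∣≤1⇒-2i∈ -[1+ suc _ ]       (s≤s ())

nearSquare-∣balance∣ : 1 ≤ n → n ≢ 2 → ∀ f → EdgeBalanced (K n) f → ∃ (NearSquare n ∣ balance f ∣)
-- By `balance²`, `n` is the square of the balance minus `2 * e`, which forces the offset
-- `-[1+ 1 ] * e`.
nearSquare-∣balance∣ {n} 1≤n n≢2 f balanced = -[1+ 1 ] * e , ∣balance∣≥1 , δ∈ , n≡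
  where
  e = pairSum f
  δ∈ = ∣i∣≤1⇒-2i∈ e (edgeBalanced⁻ f balanced)
  cancel : ∀ n e → n ≡ n + + 2 * e + -[1+ 1 ] * e
  cancel = solve-∀
  n≡ : + n ≡ + (∣ balance f ∣ ^ 2) + -[1+ 1 ] * e
  n≡ = begin
    + n                                   ≡⟨ cancel (+ n) e ⟩
    + n + + 2 * e + -[1+ 1 ] * e          ≡⟨ cong (_+ -[1+ 1 ] * e) (balance² f) ⟨
    balance f * balance f + -[1+ 1 ] * e  ≡⟨ cong (_+ -[1+ 1 ] * e) (square-∣ balance f ∣) ⟨
    + (∣ balance f ∣ ^ 2) + -[1+ 1 ] * e  ∎
    where open ≡-Reasoning
  -- A balance of 0 would make `n` itself one of -2, 0, 2.
  n∉ : ∀ {δ} → δ ∈ (-[1+ 1 ] ∷ + 0 ∷ + 2 ∷ []) → + n ≢ 0ℤ + δ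
  n∉ (here refl)                 ()
  n∉ (there (here refl))         eq = contradiction (sym (ℤ.+-injective eq)) (ℕ.<⇒≢ 1≤n)
  n∉ (there (there (here refl))) eq = n≢2 (ℤ.+-injective eq)
  ∣balance∣≥1 : 1 ≤ ∣ balance f ∣
  ∣balance∣≥1 with ∣ balance f ∣ | n≡
  ... | zero  | n≡δ = contradiction n≡δ (n∉ δ∈)
  ... | suc _ | _   = s≤s z≤n

-- If the root `j` exceeded the positive root `k`, their squares would differ by 3 or by at least 5,
-- whereas two offsets differ by 0, 2 or 4.
nearSquare-root-≤ : ∀ {j k δ δ′} → NearSquare n j δ → NearSquare n k δ′ → j ≤ k
nearSquare-root-≤ {n} {j} {suc k} {δ} {δ′} (_ , δ∈ , n≡j²+δ) (_ , δ′∈ , n≡k²+δ′) =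
  ℕ.≮⇒≥ (λ k<j → gap (proj₁ (ℕ.m≤n⇒∃[o]m+o≡n k<j)) (proj₂ (ℕ.m≤n⇒∃[o]m+o≡n k<j)))
  where
  -- From here on the smaller root is `suc k` and the larger is `2 + k + t`; their squares differ by
  -- `3 + X t`.
  X : ℕ → ℕ
  X t = k ℕ.+ k ℕ.+ t ℕ.* (4 ℕ.+ 2 ℕ.* k ℕ.+ t)
  -- The squares are written as _^ 2 unfolds, since the ring solver rejects the power.
  square : ∀ k t → (2 ℕ.+ k ℕ.+ t) ℕ.* ((2 ℕ.+ k ℕ.+ t) ℕ.* 1) ≡
    suc k ℕ.* (suc k ℕ.* 1) ℕ.+ (3 ℕ.+ (k ℕ.+ k ℕ.+ t ℕ.* (4 ℕ.+ 2 ℕ.* k ℕ.+ t)))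
  square = ℕ-Solver.solve-∀
  X≢1 : ∀ k t → k ℕ.+ k ℕ.+ t ℕ.* (4 ℕ.+ 2 ℕ.* k ℕ.+ t) ≢ 1
  X≢1 zero    zero    ()
  X≢1 zero    (suc t) ()
  -- Moving the inner `suc` outwards shows that the left-hand side is at least 2.
  X≢1 (suc k) t       eq with trans (cong (λ m → suc m ℕ.+ t ℕ.* (4 ℕ.+ 2 ℕ.* suc k ℕ.+ t)) (sym (ℕ.+-suc k k))) eq
  ... | ()
  apart : ∀ t {δ δ′} → δ ∈ (-[1+ 1 ] ∷ + 0 ∷ + 2 ∷ []) → δ′ ∈ (-[1+ 1 ] ∷ + 0 ∷ + 2 ∷ []) →
          + (3 ℕ.+ X t) + δ ≢ δ′
  -- The offsets -2 and 2 are the only pair whose gap reaches 3; they would need `X t` to be 1. The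
  -- other eight cases are refuted by computation.
  apart t (here refl) (there (there (here refl))) eq = X≢1 k t (ℕ.suc-injective (ℤ.+-injective eq))
  apart t (here refl) (here refl)                 ()
  apart t (here refl) (there (here refl))         ()
  apart t (there (here refl)) (here refl)                 ()
  apart t (there (here refl)) (there (here refl))         ()
  apart t (there (here refl)) (there (there (here refl))) ()
  apart t (there (there (here refl))) (here refl)                 ()
  apart t (there (there (here refl))) (there (here refl))         ()
  apart t (there (there (here refl))) (there (there (here refl))) ()
  gap : ∀ t → ¬ 2 ℕ.+ k ℕ.+ t ≡ j
  gap t refl = apart t δ∈ δ′∈ (cancelˡ ℤ.+-0-abelianGroup (+ (suc k ^ 2)) _ _ (begin
    + (suc k ^ 2) + (+ (3 ℕ.+ X t) + δ)  ≡⟨ ℤ.+-assoc (+ (suc k ^ 2)) (+ (3 ℕ.+ X t)) δ ⟨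
    + (suc k ^ 2 ℕ.+ (3 ℕ.+ X t)) + δ    ≡⟨ cong (λ m → + m + δ) (square k t) ⟨
    + (j ^ 2) + δ                        ≡⟨ n≡j²+δ ⟨
    + n                                  ≡⟨ n≡k²+δ′ ⟩
    + (suc k ^ 2) + δ′                   ∎))
    where open ≡-Reasoning

-- The `m` new labels shift the balance by at most `m` and must bring it within 1 of zero, so its
-- absolute value, itself a near-square root and hence at least `j`, is at most `1 + m`.
cvd-lower-bound : ∀ {j δ} → 1 ≤ n → n ≢ 2 → NearSquare n j δ →
  ∀ m → CordialAfterAdding (K n) m → j ∸ 1 ≤ m
cvd-lower-bound {n} {j} 1≤n n≢2 near m (f , balanced , g , friendly , _) =
  ℕ.∸-monoˡ-≤ 1 (begin
    j                                          ≤⟨ nearSquare-root-≤ near (proj₂ (nearSquare-∣balance∣ 1≤n n≢2 f balanced)) ⟩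
    ∣ balance f ∣                              ≡⟨ cong ∣_∣ (cancel (balance f) (balance g)) ⟩
    ∣ balance f + balance g + - balance g ∣    ≤⟨ ℤ.∣i-j∣≤∣i∣+∣j∣ (balance f + balance g) (balance g) ⟩
    ∣ balance f + balance g ∣ ℕ.+ ∣ balance g ∣  ≤⟨ ℕ.+-mono-≤ friendly′ (∣balance∣≤n g) ⟩
    1 ℕ.+ m                                    ∎)
  where
  open ℕ.≤-Reasoning
  cancel : ∀ x y → x ≡ x + y + - y
  cancel = solve-∀
  friendly′ : ∣ balance f + balance g ∣ ≤ 1
  friendly′ = subst (_≤ 1) (trans (∣counts∣≡∣balance∣ (f ++ g)) (cong ∣_∣ (balance-++ f g))) friendly

-- Upper bound: a labeling with prescribed balance.

pronic-even : ∀ i → ∃[ t ] i ℕ.* suc i ≡ t ℕ.+ t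
pronic-even zero    = 0 , refl
pronic-even (suc i) = suc i ℕ.+ proj₁ (pronic-even i) ,
  trans (step i) (trans (cong (ℕ._+ (suc i ℕ.+ suc i)) (proj₂ (pronic-even i))) (regroup i (proj₁ (pronic-even i))))
  where
  step : ∀ i → suc i ℕ.* suc (suc i) ≡ i ℕ.* suc i ℕ.+ (suc i ℕ.+ suc i)
  step = ℕ-Solver.solve-∀
  regroup : ∀ i t → t ℕ.+ t ℕ.+ (suc i ℕ.+ suc i) ≡ suc i ℕ.+ t ℕ.+ (suc i ℕ.+ t)
  regroup = ℕ-Solver.solve-∀

square-excess : ∀ i → ∃[ t ] suc i ^ 2 ≡ suc i ℕ.+ (t ℕ.+ t)
square-excess i = proj₁ (pronic-even i) , trans (expand i) (cong (suc i ℕ.+_) (proj₂ (pronic-even i)))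
  where
  expand : ∀ i → suc i ℕ.* (suc i ℕ.* 1) ≡ suc i ℕ.+ i ℕ.* suc i
  expand = ℕ-Solver.solve-∀

-- Makes room for a labeling of balance `j`: the remaining vertices must split into two equal
-- halves. This works because `j ^ 2` and `j` have the same parity and every offset is even.
nearSquare-excess : ∀ {j δ} → NearSquare n j δ → ∃[ t ] n ≡ j ℕ.+ (t ℕ.+ t)
nearSquare-excess {j = suc i} (_ , there (here refl) , n≡) =
  map₂ (trans (trans (ℤ.+-injective n≡) (ℕ.+-identityʳ _))) (square-excess i)
nearSquare-excess {j = suc i} (_ , there (there (here refl)) , n≡) =
  let t , eq = square-excess i in
  suc t , trans (ℤ.+-injective n≡) (trans (cong (ℕ._+ 2) eq) (regroup i t))
  where
  regroup : ∀ i t → suc i ℕ.+ (t ℕ.+ t) ℕ.+ 2 ≡ suc i ℕ.+ (suc t ℕ.+ suc t)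
  regroup = ℕ-Solver.solve-∀
-- Here `n` would be 1 - 2, which is negative.
nearSquare-excess {j = 1}           (_ , here refl , ())
nearSquare-excess {n} {j = suc (suc i)} (_ , here refl , n≡) =
  t , ℕ.+-cancelʳ-≡ 2 _ _ (trans n+2≡j² (trans (proj₂ (square-excess (suc i))) (regroup (suc i) t)))
  where
  -- `square-excess (suc i)` computes to the half `suc t`; the offset -2 takes one vertex from each
  -- half.
  t = i ℕ.+ proj₁ (pronic-even i)
  n+2≡j² : n ℕ.+ 2 ≡ suc (suc i) ^ 2
  n+2≡j² = ℤ.+-injective (trans (cong (_+ + 2) n≡)
    (trans (ℤ.+-assoc (+ (suc (suc i) ^ 2)) -[1+ 1 ] (+ 2)) (ℤ.+-identityʳ _)))
  regroup : ∀ i t → suc i ℕ.+ (suc t ℕ.+ suc t) ≡ suc i ℕ.+ (t ℕ.+ t) ℕ.+ 2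
  regroup = ℕ-Solver.solve-∀

halved : ∀ j t → Vector Parity (j ℕ.+ (t ℕ.+ t))
halved j t = const {B = Fin j} 0ℙ ++ (const {B = Fin t} 0ℙ ++ const {B = Fin t} 1ℙ)

balance-halved : ∀ j t → balance (halved j t) ≡ + j
balance-halved j t = begin
  balance (halved j t)
    ≡⟨ balance-++ {j} {t ℕ.+ t} (const 0ℙ) _ ⟩
  balance {j} (const 0ℙ) + balance (const {B = Fin t} 0ℙ ++ const {B = Fin t} 1ℙ)
    ≡⟨ cong₂ _+_ (balance-const j 0ℙ) (balance-++ {t} {t} (const 0ℙ) (const 1ℙ)) ⟩
  + j * 1ℤ + (balance {t} (const 0ℙ) + balance {t} (const 1ℙ))
    ≡⟨ cong (_+_ (+ j * 1ℤ)) (cong₂ _+_ (balance-const t 0ℙ) (balance-const t 1ℙ)) ⟩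
  + j * 1ℤ + (+ t * 1ℤ + + t * -1ℤ)
    ≡⟨ cancel (+ j) (+ t) ⟩
  + j ∎
  where
  open ≡-Reasoning
  cancel : ∀ j t → j * 1ℤ + (t * 1ℤ + t * -1ℤ) ≡ j
  cancel = solve-∀

∣δ∣≤2 : ∀ {δ} → δ ∈ (-[1+ 1 ] ∷ + 0 ∷ + 2 ∷ []) → ∣ δ ∣ ≤ 2
∣δ∣≤2 (here refl)                 = ℕ.≤-refl
∣δ∣≤2 (there (here refl))         = z≤n
∣δ∣≤2 (there (there (here refl))) = ℕ.≤-refl

-- Now `balance²` is read backwards: `2 * e` equals `- δ`, and halving the bound 2 on the offset
-- gives the bound 1 on `e`.
nearSquare⇒edgeBalanced : ∀ {j δ} → NearSquare n j δ → ∀ f → balance f ≡ + j → EdgeBalanced (K n) f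
nearSquare⇒edgeBalanced {n} {j} {δ} (_ , δ∈ , n≡) f f≡j = edgeBalanced⁺ f (ℕ.*-cancelˡ-≤ 2 (begin
  2 ℕ.* ∣ e ∣    ≡⟨ ℤ.∣i*j∣≡∣i∣*∣j∣ (+ 2) e ⟨
  ∣ + 2 * e ∣    ≡⟨ cong ∣_∣ 2e≡-δ ⟩
  ∣ - δ ∣        ≡⟨ ℤ.∣-i∣≡∣i∣ δ ⟩
  ∣ δ ∣          ≤⟨ ∣δ∣≤2 δ∈ ⟩
  2              ∎))
  where
  open ℕ.≤-Reasoning
  e = pairSum f
  isolate : ∀ s n e δ → s ≡ n + + 2 * e → n ≡ s + δ → + 2 * e ≡ - δ
  isolate s n e δ s≡ n≡ = trans (cancel n e) (trans (cong₂ (λ x y → x + - y) (sym s≡) n≡) (cancel′ s δ))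
    where
    cancel : ∀ n e → + 2 * e ≡ n + + 2 * e + - n
    cancel = solve-∀
    cancel′ : ∀ s δ → s + - (s + δ) ≡ - δ
    cancel′ = solve-∀
  2e≡-δ : + 2 * e ≡ - δ
  2e≡-δ = isolate (+ (j ^ 2)) (+ n) e δ
    (trans (square-∣ + j ∣) (trans (cong₂ _*_ (sym f≡j) (sym f≡j)) (balance² f))) n≡

cvd-upper-bound : ∀ {j δ} → NearSquare n j δ → CordialAfterAdding (K n) (j ∸ 1)
cvd-upper-bound {n} {suc i} near with nearSquare-excess near
-- Label 0 has a surplus of `suc i`; giving all `i` new vertices the label 1 reduces it to exactly
-- 1.
... | t , refl = f , balanced , const 1ℙ , friendly , edgeBalanced-addIsolated (K n) i f (const 1ℙ) balanced
  where
  f : Labeling (K n)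
  f = halved (suc i) t
  balanced : EdgeBalanced (K n) f
  balanced = nearSquare⇒edgeBalanced near f (balance-halved (suc i) t)
  collapse : ∀ i → 1ℤ + i + i * -1ℤ ≡ 1ℤ
  collapse = solve-∀
  friendly : Friendly (addIsolated (K n) i) (f ++ const 1ℙ)
  friendly = ℕ.≤-reflexive (begin
    ∣ ∣ f ++ const {B = Fin i} 1ℙ ⁻¹ 0ℙ ∣ - ∣ f ++ const {B = Fin i} 1ℙ ⁻¹ 1ℙ ∣ ∣  ≡⟨ ∣counts∣≡∣balance∣ (f ++ const {B = Fin i} 1ℙ) ⟩
    ∣ balance (f ++ const {B = Fin i} 1ℙ) ∣      ≡⟨ cong ∣_∣ (balance-++ f (const {B = Fin i} 1ℙ)) ⟩
    ∣ balance f + balance {i} (const 1ℙ) ∣       ≡⟨ cong ∣_∣ (cong₂ _+_ (balance-halved (suc i) t) (balance-const i 1ℙ)) ⟩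
    ∣ + suc i + + i * -1ℤ ∣                      ≡⟨ cong ∣_∣ (collapse (+ i)) ⟩
    1                                            ∎)
    where open ≡-Reasoning

theorem3 : (n : ℕ) → 1 ≤ n →
    ((j : ℕ) (δ : ℤ) → NearSquare n j δ → n ≢ 2 → IsCVD (K n) [ j ∸ 1 ])
    × (¬ ∃₂ (NearSquare n) → IsCVD (K n) ⊤⁺)
theorem3 n 1≤n =
    (λ j δ near n≢2 → cvd-upper-bound near , cvd-lower-bound 1≤n n≢2 near)
  , λ { ¬near (f , balanced) → ¬near (nearSquare f balanced) }
  where
  nearSquare : ∀ f → EdgeBalanced (K n) f → ∃₂ (NearSquare n)
  nearSquare f balanced with n ℕ.≟ 2
  -- The balance of `K 2` may be 0, which is no admissible root, so the form 2 = 2² - 2 is supplied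
  -- directly.
  ... | yes refl = 2 , -[1+ 1 ] , s≤s z≤n , here refl , refl
  ... | no  n≢2  = _ , nearSquare-∣balance∣ 1≤n n≢2 f balanced
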